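{- Let $\mathcal{S}$ be a nonempty set with a scene space basis $\mathcal{B}$ and let $P$ be a program over $\mathcal{S}$. Say that a set of variables $S\subseteq\mathcal{B}$ satisfies the coincidence effect property of $P$ if for every $V$ with $S\subseteq V\subseteq\mathcal{B}$ and all $s_0,s_1,s_0'\in\mathcal{S}$: if $s_0\approx s_1$ on $\bigcup V$ and $P(s_0,s_0')$, then there exists $s_1'\in\mathcal{S}$ such that $P(s_1,s_1')$ and $s_0'\approx s_1'$ on $\bigcup V$. Then $FV(P)$ is the smallest such set: $FV(P)$ satisfies the coincidence effect property of $P$, and $FV(P)\subseteq S$ for every $S\subseteq\mathcal{B}$ satisfying the coincidence effect property of $P$.
   Context: Scenes. Let $\mathcal{S}$ be a nonempty set (of states). A scene on $\mathcal{S}$ is a function $A:\mathcal{S}\to\mathcal{S}\to\mathcal{S}$ satisfying for all $x,y,z$: $A\,(A\,x\,y)\,z = A\,x\,z$, $A\,x\,(A\,y\,z)=A\,x\,z$, $A\,x\,x=x$. Write $\bot = (\lambda s_1\,s_2.\ s_1)$, $\top=(\lambda s_1\,s_2.\ s_2)$, $A^{\complement}=(\lambda s_1\,s_2.\ A\,s_2\,s_1)$, $A\sqcup B=(\lambda s_1\,s_2.\ B\,(A\,s_1\,s_2)\,s_2)$. Scenes $A,B$ are independent if $B\,(A\,s_1\,s_2)\,s_3=A\,(B\,s_1\,s_3)\,s_2$ for all $s_1,s_2,s_3$. Write "$s_1\approx s_2$ on $A$" for $A\,s_1\,s_2=s_1$. A scene space basis is a finite sequence of scenes $S_1,\dots,S_n$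 with $S_i,S_j$ independent for $i\neq j$ and $S_1\sqcup\cdots\sqcup S_n=\top$; $\mathcal{B}=\{S_1,\dots,S_n\}$ (the variables). For a set $X\subseteq\mathcal{B}$, $\bigcup X$ denotes the $\sqcup$ of all its elements (in any order, the result being independent of it), with $\bigcup\emptyset=\bot$. A program is a binary predicate $P(s,s')$ on $\mathcal{S}$. Free variables of a program: $FV(P)$ is the set of $x\in\mathcal{B}$ for which there exist $s_0,s_0',s_1\in\mathcal{S}$ such that $s_0\approx s_1$ on $x^{\complement}$, $P(s_0,s_0')$, and there is no $s_1'$ with $s_0'\approx s_1'$ on $x^{\complement}$ and $P(s_1,s_1')$. -}

module Defs where

open import Level using (Level; suc)
open import Algebra.Core using (Op₂)
open import Axiom.ExcludedMiddle using (ExcludedMiddle)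
open import Data.Fin.Base using (Fin)
open import Data.List.Base using (List; foldr; filter; tabulate)
open import Data.Nat.Base using (ℕ)
open import Data.Product using (∃; _×_; _,_)
open import Relation.Binary.Core using (Rel)
open import Relation.Binary.Definitions using (_Respects_)
open import Relation.Binary.PropositionalEquality using (_≡_; _≢_; sym; trans)
open import Relation.Nullary using (¬_)
open import Relation.Unary using (Pred; _∈_; _⊆_)

private
  variable
    ℓ : Level
    𝒮 : Set ℓ
    n : ℕ

record IsScene {𝒮 : Set ℓ} (A : Op₂ 𝒮) : Set ℓ where
  field
    overrideˡ  : ∀ x y z → A (A x y) z ≡ A x z
    overrideʳ  : ∀ x y z → A x (A y z) ≡ A x z
    idempotent : ∀ x → A x x ≡ x

-- Equality of scenes is pointwise, since function extensionality is not
-- available. The operations below act on arbitrary binary functions, because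
-- the join of two scenes need not be a scene.

infix 4 _≐_

_≐_ : Rel (Op₂ {ℓ} 𝒮) ℓ
A ≐ B = ∀ s₁ s₂ → A s₁ s₂ ≡ B s₁ s₂

⊥ₛ : Op₂ 𝒮
⊥ₛ s₁ s₂ = s₁

⊤ₛ : Op₂ 𝒮
⊤ₛ s₁ s₂ = s₂

infix 8 _ᶜ

_ᶜ : Op₂ 𝒮 → Op₂ 𝒮
(A ᶜ) s₁ s₂ = A s₂ s₁

infixr 6 _⊔ₛ_

_⊔ₛ_ : Op₂ 𝒮 → Op₂ 𝒮 → Op₂ 𝒮
(A ⊔ₛ B) s₁ s₂ = B (A s₁ s₂) s₂

⨆ : List (Op₂ 𝒮) → Op₂ 𝒮
⨆ = foldr _⊔ₛ_ ⊥ₛ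

Independent : Op₂ {ℓ} 𝒮 → Op₂ 𝒮 → Set ℓ
Independent A B = ∀ s₁ s₂ s₃ → B (A s₁ s₂) s₃ ≡ A (B s₁ s₃) s₂

infix 4 _≈_on_

_≈_on_ : 𝒮 → 𝒮 → Op₂ {ℓ} 𝒮 → Set ℓ
s₁ ≈ s₂ on A = A s₁ s₂ ≡ s₁

record SceneSpaceBasis (𝒮 : Set ℓ) (n : ℕ) : Set ℓ where
  field
    scene       : Fin n → Op₂ 𝒮
    isScene     : ∀ i → IsScene (scene i)
    independent : ∀ {i j} → i ≢ j → Independent (scene i) (scene j)
    complete    : ⨆ (tabulate scene) ≐ ⊤ₛ

open SceneSpaceBasis

Variables : {𝒮 : Set ℓ} → SceneSpaceBasis 𝒮 n → Pred (Op₂ 𝒮) ℓ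
Variables b x = ∃ λ i → x ≐ scene b i

-- Subsets of Variables b. Respecting _≐_ makes them sets of scenes rather
-- than sets of intensionally distinguished functions.

record VarSet {𝒮 : Set ℓ} (b : SceneSpaceBasis 𝒮 n) : Set (suc ℓ) where
  field
    ⟦_⟧      : Pred (Op₂ 𝒮) ℓ
    respects : ⟦_⟧ Respects _≐_
    bounded  : ⟦_⟧ ⊆ Variables b

open VarSet public using (⟦_⟧)

-- Selecting the elements of X from the basis sequence uses excluded middle to
-- decide membership. A scene occurring several times in the sequence is joined
-- several times; this is harmless, as A ⊔ₛ A ≐ A for every scene A.

⋃ : ExcludedMiddle ℓ → {𝒮 : Set ℓ} {b : SceneSpaceBasis 𝒮 n} →
    VarSet b → Op₂ 𝒮
⋃ em {b = b} X = ⨆ (filter (λ x → em {x ∈ ⟦ X ⟧}) (tabulate (scene b)))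

-- Programs are relations P : Rel 𝒮 ℓ from initial to final states.

FV : {𝒮 : Set ℓ} (b : SceneSpaceBasis 𝒮 n) → Rel 𝒮 ℓ → VarSet b
FV {𝒮 = 𝒮} b P = record
  { ⟦_⟧ = λ x → x ∈ Variables b × Free x
  ; respects = λ where
      x≐y ((i , x≐i) , s₀ , s₀′ , s₁ , s₀≈s₁ , Ps₀s₀′ , ∄s₁′) →
        (i , λ s t → trans (sym (x≐y s t)) (x≐i s t)) ,
        s₀ , s₀′ , s₁ , trans (sym (x≐y s₁ s₀)) s₀≈s₁ , Ps₀s₀′ ,
        λ (s₁′ , s₀′≈s₁′ , Ps₁s₁′) →
          ∄s₁′ (s₁′ , trans (x≐y s₁′ s₀′) s₀′≈s₁′ , Ps₁s₁′)
  ; bounded = λ (x∈B , _) → x∈B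
  }
  where
  Free : Op₂ 𝒮 → Set _
  Free x = ∃ λ s₀ → ∃ λ s₀′ → ∃ λ s₁ →
    s₀ ≈ s₁ on x ᶜ × P s₀ s₀′ ×
    ¬ (∃ λ s₁′ → s₀′ ≈ s₁′ on x ᶜ × P s₁ s₁′)

CoincidenceEffect : ExcludedMiddle ℓ → {𝒮 : Set ℓ} {b : SceneSpaceBasis 𝒮 n} →
                    Rel 𝒮 ℓ → VarSet b → Set (suc ℓ)
CoincidenceEffect em {b = b} P S =
  ∀ (V : VarSet b) → ⟦ S ⟧ ⊆ ⟦ V ⟧ →
  ∀ s₀ s₁ s₀′ → s₀ ≈ s₁ on ⋃ em V → P s₀ s₀′ →
  ∃ λ s₁′ → P s₁ s₁′ × s₀′ ≈ s₁′ on ⋃ em V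

{-# OPTIONS --safe #-}

-- Agreement on a join of variables is agreement on each of them, so everything
-- can be argued one variable at a time. For the coincidence effect property of
-- FV(P), move from s₀ to s₁ by overriding one variable after the other: a
-- variable of V changes nothing, and any other variable is not free, so the
-- final state can follow while changing only in that variable. For minimality,
-- if x ∈ FV(P) were not in S, the property for V = 𝓑 ∖ {x} would contradict
-- the witnesses of x ∈ FV(P), because agreement on ⋃ (𝓑 ∖ {x}) is agreement
-- on xᶜ.
module Submission where

open import Defs
open import Level using (Level)
open import Algebra.Core using (Op₂)
open import Axiom.ExcludedMiddle using (ExcludedMiddle)
open import Data.Fin.Base using (Fin)
open import Data.List.Base using (List; []; _∷_; tabulate)
open import Data.List.Membership.Propositional using () renaming (_∈_ to _∈ₗ_)
open import Data.List.Membership.Propositional.Properties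
  using (∈-filter⁺; ∈-filter⁻; ∈-tabulate⁺; ∈-tabulate⁻)
open import Data.List.Relation.Unary.All as All using (All; []; _∷_)
open import Data.List.Relation.Unary.All.Properties using (tabulate⁺)
open import Data.List.Relation.Unary.AllPairs using (AllPairs; _∷_)
import Data.List.Relation.Unary.AllPairs.Properties as AllPairs
open import Data.List.Relation.Unary.Any using (here; there)
open import Data.Nat.Base using (ℕ)
open import Data.Product using (∃; _×_; _,_; proj₁)
open import Relation.Binary.Core using (Rel)
open import Relation.Binary.PropositionalEquality
  using (_≡_; refl; sym; trans; cong; subst; module ≡-Reasoning)
open import Relation.Nullary using (¬_; yes; no)
open import Relation.Nullary.Decidable using (decidable-stable)
open import Relation.Unary using (_∈_; _∉_; _⊆_)

private
  variable
    ℓ : Level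
    𝒮 : Set ℓ
    A B : Op₂ 𝒮
    L : List (Op₂ 𝒮)
    r s t : 𝒮

module _ {A : Op₂ {ℓ} 𝒮} (isScene : IsScene A) where
  open IsScene isScene

  ≈-sym : s ≈ t on A → t ≈ s on A
  ≈-sym {s = s} {t = t} s≈t = begin
    A t s          ≡⟨ cong (A t) s≈t ⟨
    A t (A s t)    ≡⟨ overrideʳ t s t ⟩
    A t t          ≡⟨ idempotent t ⟩
    t              ∎
    where open ≡-Reasoning

  ≈-trans : r ≈ s on A → s ≈ t on A → r ≈ t on A
  ≈-trans {r = r} {s = s} {t = t} r≈s s≈t = begin
    A r t          ≡⟨ overrideʳ r s t ⟨
    A r (A s t)    ≡⟨ cong (A r) s≈t ⟩
    A r s          ≡⟨ r≈s ⟩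
    r              ∎
    where open ≡-Reasoning

  ≈-override-ᶜ : ∀ s t → s ≈ A s t on A ᶜ
  ≈-override-ᶜ s t = trans (overrideˡ s t s) (idempotent s)

  -- The hypothesis writes `s` as `t` overridden at `B`, and by independence such an override
  -- commutes with `A`.
  ≈-ᶜ⇒≈-independent : Independent B A → s ≈ t on B ᶜ → s ≈ t on A
  ≈-ᶜ⇒≈-independent {B = B} {s = s} {t = t} B#A s≈t = begin
    A s t          ≡⟨ cong (λ r → A r t) s≈t ⟨
    A (B t s) t    ≡⟨ B#A t s t ⟩
    B (A t t) s    ≡⟨ cong (λ r → B r s) (idempotent t) ⟩
    B t s          ≡⟨ s≈t ⟩
    s              ∎
    where open ≡-Reasoning

≈-override-independent : Independent B A → s ≈ t on A → B s t ≈ t on A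
≈-override-independent {B = B} {t = t} B#A s≈t =
  trans (B#A _ t t) (cong (λ r → B r t) s≈t)

≈-⨆⁺ : All (s ≈ t on_) L → s ≈ t on ⨆ L
≈-⨆⁺ [] = refl
≈-⨆⁺ {t = t} {L = _ ∷ L} (s≈t ∷ rest) =
  trans (cong (λ r → ⨆ L r t) s≈t) (≈-⨆⁺ rest)

⨆-independent : All (Independent A) L → Independent A (⨆ L)
⨆-independent [] s t r = refl
⨆-independent {L = B ∷ L} (A#B ∷ A#L) s t r =
  trans (cong (λ q → ⨆ L q r) (A#B s t r)) (⨆-independent A#L (B s r) t r)

-- Overrides before `A` only change the starting state. Once `A` has copied its part of `t`, the
-- later overrides commute with `A` and cannot undo this.
⨆-absorbs : All IsScene L → AllPairs Independent L → A ∈ₗ L →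
            ∀ s t → ⨆ L s t ≈ t on A
⨆-absorbs {L = A ∷ L} (isScene ∷ _) (A#L ∷ _) (here refl) s t = begin
  A (⨆ L (A s t) t) t    ≡⟨ ⨆-independent A#L (A s t) t t ⟨
  ⨆ L (A (A s t) t) t    ≡⟨ cong (λ r → ⨆ L r t) (IsScene.overrideˡ isScene s t t) ⟩
  ⨆ L (A s t) t          ∎
  where open ≡-Reasoning
⨆-absorbs (_ ∷ scenes) (_ ∷ pairs) (there A∈L) s t =
  ⨆-absorbs scenes pairs A∈L _ t

≈-⨆⁻ : All IsScene L → AllPairs Independent L → A ∈ₗ L →
        s ≈ t on ⨆ L → s ≈ t on A
≈-⨆⁻ {A = A} {s = s} {t = t} scenes pairs A∈L s≈t =
  subst (_≈ t on A) s≈t (⨆-absorbs scenes pairs A∈L s t)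

module _ (em : ExcludedMiddle ℓ) {𝒮 : Set ℓ} {n : ℕ} (b : SceneSpaceBasis 𝒮 n) where
  open SceneSpaceBasis b

  _≈_onAll_ : 𝒮 → 𝒮 → VarSet b → Set ℓ
  s ≈ t onAll V = ∀ i → scene i ∈ ⟦ V ⟧ → s ≈ t on scene i

  ≈-⋃⁺ : (V : VarSet b) → s ≈ t onAll V → s ≈ t on ⋃ em V
  ≈-⋃⁺ {s = s} {t = t} V s≈t = ≈-⨆⁺ (All.tabulate onSelected)
    where
    onSelected : ∀ {x} → x ∈ₗ _ → s ≈ t on x
    onSelected x∈L with ∈-filter⁻ (λ x → em {x ∈ ⟦ V ⟧}) {xs = tabulate scene} x∈L
    ... | x∈tab , x∈V with ∈-tabulate⁻ x∈tab
    ...   | i , refl = s≈t i x∈V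

  ≈-⋃⁻ : (V : VarSet b) → s ≈ t on ⋃ em V → s ≈ t onAll V
  ≈-⋃⁻ V s≈t i i∈V = ≈-⨆⁻
    (All.tabulate isSceneSelected)
    (AllPairs.filter⁺ dec (AllPairs.tabulate⁺ independent))
    (∈-filter⁺ dec (∈-tabulate⁺ i) i∈V)
    s≈t
    where
    dec = λ x → em {x ∈ ⟦ V ⟧}
    isSceneSelected : ∀ {x} → x ∈ₗ _ → IsScene x
    isSceneSelected x∈L
      with ∈-tabulate⁻ (proj₁ (∈-filter⁻ dec {xs = tabulate scene} x∈L))
    ... | j , refl = isScene j

  independent-∉ : (V : VarSet b) {i j : Fin n} → scene i ∉ ⟦ V ⟧ → scene j ∈ ⟦ V ⟧ →
                  Independent (scene i) (scene j)
  independent-∉ V i∉V j∈V =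
    independent (λ i≡j → i∉V (subst (λ k → scene k ∈ ⟦ V ⟧) (sym i≡j) j∈V))

  -- Removal is up to `≐`, so every occurrence of a repeated scene goes at once.
  _∖_ : VarSet b → Op₂ 𝒮 → VarSet b
  X ∖ x = record
    { ⟦_⟧      = λ y → y ∈ ⟦ X ⟧ × ¬ (y ≐ x)
    ; respects = λ y≐z (y∈X , y≭x) →
        VarSet.respects X y≐z y∈X , λ z≐x → y≭x (λ s t → trans (y≐z s t) (z≐x s t))
    ; bounded  = λ (y∈X , _) → VarSet.bounded X y∈X
    }

  basisSet : VarSet b
  basisSet = record
    { ⟦_⟧      = Variables b
    ; respects = λ y≐z (i , y≐i) → i , λ s t → trans (sym (y≐z s t)) (y≐i s t)
    ; bounded  = λ x∈B → x∈B
    }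

  ≈-ᶜ⇒≈-∖ : ∀ i → s ≈ t on scene i ᶜ → s ≈ t onAll (basisSet ∖ scene i)
  ≈-ᶜ⇒≈-∖ i s≈t j (_ , j≭i) = ≈-ᶜ⇒≈-independent (isScene j)
    (independent (λ { refl → j≭i (λ _ _ → refl) })) s≈t

  -- Overriding t by s at scene i yields a state that agrees with s on every
  -- variable, hence equals s by completeness of the basis.
  ≈-∖⇒≈-ᶜ : ∀ i → s ≈ t onAll (basisSet ∖ scene i) → s ≈ t on scene i ᶜ
  ≈-∖⇒≈-ᶜ {s = s} {t = t} i s≈t =
    trans (sym (≈-⨆⁺ (tabulate⁺ agree))) (complete (scene i t s) s)
    where
    agree : ∀ j → scene i t s ≈ s on scene j
    -- Scenes are compared rather than indices: a repetition of `scene i` at another index is absent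
    -- from `basisSet ∖ scene i`, so the hypothesis does not cover it.
    agree j with em {scene j ≐ scene i}
    ... | yes j≐i = trans (j≐i _ s) (IsScene.overrideˡ (isScene i) t s s)
    ... | no  j≭i = ≈-override-independent {B = scene i} {A = scene j}
      (independent (λ { refl → j≭i (λ _ _ → refl) }))
      (≈-sym (isScene j) (s≈t j ((j , λ _ _ → refl) , j≭i)))

  module _ (P : Rel 𝒮 ℓ) where

    notFree-step : ∀ i → scene i ∉ ⟦ FV b P ⟧ → ∀ {s₀ s₁ s₀′} →
                   s₀ ≈ s₁ on scene i ᶜ → P s₀ s₀′ →
                   ∃ λ s₁′ → s₀′ ≈ s₁′ on scene i ᶜ × P s₁ s₁′
    notFree-step i i∉FV s₀≈s₁ Ps₀s₀′ = decidable-stable em λ ∄s₁′ →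
      i∉FV ((i , λ _ _ → refl) , _ , _ , _ , s₀≈s₁ , Ps₀s₀′ , ∄s₁′)

    -- Induction on `L` with the current state `t` and its final state `t′` varying. The invariant
    -- is that `t` agrees with the target `s` on the variables of `V`; taking `L` to be the whole
    -- basis makes the path end at `s`.
    override-path : (V : VarSet b) → ⟦ FV b P ⟧ ⊆ ⟦ V ⟧ →
                    All (λ x → ∃ λ i → x ≡ scene i) L →
                    ∀ {t t′} s → t ≈ s onAll V → P t t′ →
                    ∃ λ s′ → P (⨆ L t s) s′ × t′ ≈ s′ onAll V
    override-path V FV⊆V [] s t≈s Ptt′ =
      _ , Ptt′ , λ j _ → IsScene.idempotent (isScene j) _
    override-path {L = _ ∷ L} V FV⊆V ((i , refl) ∷ L⊆B) {t} {t′} s t≈s Ptt′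
      with em {scene i ∈ ⟦ V ⟧}
    -- Agreement at `scene i` means that this override returns `t` itself.
    ... | yes i∈V = subst (λ r → ∃ λ s′ → P (⨆ L r s) s′ × t′ ≈ s′ onAll V)
      (sym (t≈s i i∈V)) (override-path V FV⊆V L⊆B s t≈s Ptt′)
    ... | no i∉V
      with r′ , t′≈r′ , Prr′ ←
        notFree-step i (λ i∈FV → i∉V (FV⊆V i∈FV)) (≈-override-ᶜ (isScene i) t s) Ptt′
      -- The path continues from `scene i t s`, which keeps the invariant because `scene i` is
      -- independent of every variable in `V`.
      with s′ , Ps′ , r′≈s′ ← override-path V FV⊆V L⊆B s
        (λ j j∈V → ≈-override-independent {B = scene i} {A = scene j}
          (independent-∉ V i∉V j∈V) (t≈s j j∈V)) Prr′
      = s′ , Ps′ , λ j j∈V → ≈-trans (isScene j)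
          (≈-ᶜ⇒≈-independent (isScene j) (independent-∉ V i∉V j∈V) t′≈r′)
          (r′≈s′ j j∈V)

    FV-coincidenceEffect : CoincidenceEffect em P (FV b P)
    FV-coincidenceEffect V FV⊆V s₀ s₁ s₀′ s₀≈s₁ Ps₀s₀′
      with s₁′ , Ps₁s₁′ , s₀′≈s₁′ ←
        override-path V FV⊆V (tabulate⁺ (λ i → i , refl)) s₁ (≈-⋃⁻ V s₀≈s₁) Ps₀s₀′
      = s₁′ , subst (λ s → P s s₁′) (complete s₀ s₁) Ps₁s₁′ , ≈-⋃⁺ V s₀′≈s₁′

    scene∈FV⇒∈ : (S : VarSet b) → CoincidenceEffect em P S →
                 ∀ i → scene i ∈ ⟦ FV b P ⟧ → scene i ∈ ⟦ S ⟧
    scene∈FV⇒∈ S ce i (_ , s₀ , s₀′ , s₁ , s₀≈s₁ , Ps₀s₀′ , ∄s₁′) =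
      decidable-stable em λ i∉S →
        let V = basisSet ∖ scene i
            -- A member of `S` pointwise equal to `scene i` would put `scene i` itself into `S`.
            S⊆V = λ {y} y∈S → VarSet.bounded S {y} y∈S ,
                              λ y≐i → i∉S (VarSet.respects S y≐i y∈S)
            s₁′ , Ps₁s₁′ , s₀′≈s₁′ =
              ce V S⊆V s₀ s₁ s₀′ (≈-⋃⁺ V (≈-ᶜ⇒≈-∖ i s₀≈s₁)) Ps₀s₀′
        in ∄s₁′ (s₁′ , ≈-∖⇒≈-ᶜ i (≈-⋃⁻ V s₀′≈s₁′) , Ps₁s₁′)

    FV-smallest : (S : VarSet b) → CoincidenceEffect em P S → ⟦ FV b P ⟧ ⊆ ⟦ S ⟧
    -- A variable is only pointwise equal to some `scene i`, so membership is transported to that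
    -- representative and back.
    FV-smallest S ce x∈FV@((i , x≐i) , _) =
      VarSet.respects S (λ s t → sym (x≐i s t))
        (scene∈FV⇒∈ S ce i (VarSet.respects (FV b P) x≐i x∈FV))

lemma36 : ∀ {ℓ : Level} (em : ExcludedMiddle ℓ) (𝒮 : Set ℓ) (nonempty : 𝒮)
    (n : ℕ) (b : SceneSpaceBasis 𝒮 n) (P : Rel 𝒮 ℓ) →
    CoincidenceEffect em P (FV b P) ×
    (∀ (S : VarSet b) → CoincidenceEffect em P S → ⟦ FV b P ⟧ ⊆ ⟦ S ⟧)
lemma36 em 𝒮 nonempty n b P = FV-coincidenceEffect em b P , FV-smallest em b P
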